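{- Let $k\ge 2$ be an integer and let $\mathcal{H}=(V,E)$ be a $k$-uniform and $(k+1)$-regular linear hypergraph. Then $\mathrm{q}(\mathcal{H})\le\Delta([\mathcal{H}]_2)+1$.
   Context: A hypergraph $\mathcal{H}=(V,E)$ consists of a finite nonempty set $V$ of vertices and a nonempty set $E$ of nonempty subsets of $V$, called hyperedges. The degree of a vertex $x\in V$ is $\deg_{\mathcal{H}}(x)=|\{a\in E: x\in a\}|$. $\mathcal{H}$ is $k$-uniform if $|e|=k$ for all $e\in E$, and $d$-regular if $\deg_{\mathcal{H}}(x)=d$ for all $x\in V$. $\mathcal{H}$ is linear if $|e\cap e'|\le 1$ for every pair of distinct hyperedges $e,e'\in E$. The 2-section of $\mathcal{H}$ is the loopless multigraph $[\mathcal{H}]_2$ with vertex set $V$ in which two distinct vertices $x,y$ are joined by exactly $m$ parallel edges, where $m$ is the number of hyperedges of $\mathcal{H}$ containing both $x$ and $y$ (it is a simple graph when $\mathcal{H}$ is linear). $\Delta([\mathcal{H}]_2)$ denotes its maximum degree. The chromatic index $\mathrm{q}(\mathcal{H})$ is the least integer $q$ such that there exists a map $c:E\to\{1,2,\dots,q\}$ satisfying: for all $e,e'\in E$, $c(e)=c(e')$ implies $e\cap e'=\varnothing$ or $e=e'$. -}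

module Defs where

open import Data.Bool.Base using (if_then_else_)
open import Data.Fin.Base using (Fin; finToFun; funToFin)
open import Data.Fin.Properties using (_≟_; all?; any?; finToFun-funToFin)
open import Data.Fin.Subset using (Subset; Nonempty; Empty; _∩_; ∣_∣)
open import Data.Fin.Subset.Properties using (_∈?_; nonempty?; ∩-comm)
open import Data.Nat.Base using (ℕ; zero; suc; _≤_; _⊔_; z≤n; s≤s; NonZero)
open import Data.Nat.Properties using (+-0-commutativeMonoid)
open import Data.Product.Base using (∃; _×_; _,_; proj₁; proj₂)
open import Data.Sum.Base using (_⊎_; inj₂)
open import Data.Vec.Base using (tabulate)
open import Data.Vec.Functional using (foldr)
open import Data.Vec.Properties using (≡-dec)
import Data.Bool.Properties as Bool
open import Algebra.Properties.CommutativeMonoid.Sum +-0-commutativeMonoid using (sum)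
open import Function.Definitions using (Injective)
open import Relation.Binary.PropositionalEquality
  using (_≡_; _≢_; _≗_; refl; sym; trans; cong)
open import Relation.Nullary.Decidable
  using (Dec; yes; no; does; map′; ¬?; _⊎-dec_; _→-dec_)
open import Relation.Nullary.Negation using (contradiction)
open import Relation.Unary using (Pred; Decidable)

-- The vertex set is Fin order.  The set E of hyperedges is enumerated
-- without repetition by Fin size, so a quantifier over e ∈ E becomes a
-- quantifier over i : Fin size with e = edge i.
record Hypergraph : Set where
  field
    order          : ℕ
    size           : ℕ
    order-nonZero  : NonZero order
    size-nonZero   : NonZero size
    edge           : Fin size → Subset order
    edge-injective : Injective _≡_ _≡_ edge
    edge-nonempty  : ∀ i → Nonempty (edge i)

  Vertex : Set
  Vertex = Fin order

  star : Vertex → Subset size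
  star x = tabulate λ i → does (x ∈? edge i)

  degree : Vertex → ℕ
  degree x = ∣ star x ∣

open Hypergraph

Uniform : ℕ → Hypergraph → Set
Uniform k H = ∀ i → ∣ edge H i ∣ ≡ k

Regular : ℕ → Hypergraph → Set
Regular d H = ∀ x → degree H x ≡ d

Linear : Hypergraph → Set
Linear H = ∀ i j → edge H i ≢ edge H j → ∣ edge H i ∩ edge H j ∣ ≤ 1

record LooplessMultigraph (n : ℕ) : Set where
  field
    multiplicity : Fin n → Fin n → ℕ
    symmetric    : ∀ x y → multiplicity x y ≡ multiplicity y x
    loopless     : ∀ x → multiplicity x x ≡ 0

open LooplessMultigraph

graphDegree : ∀ {n} → LooplessMultigraph n → Fin n → ℕ
graphDegree G x = sum (multiplicity G x)

Δ : ∀ {n} → LooplessMultigraph n → ℕ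
Δ G = foldr _⊔_ 0 (graphDegree G)

[_]₂ : (H : Hypergraph) → LooplessMultigraph (order H)
[ H ]₂ = record { multiplicity = mult ; symmetric = mult-sym ; loopless = mult-irrefl }
  where
  mult : Vertex H → Vertex H → ℕ
  mult x y = if does (x ≟ y) then 0 else ∣ star H x ∩ star H y ∣

  mult-sym : ∀ x y → mult x y ≡ mult y x
  mult-sym x y with x ≟ y | y ≟ x
  ... | yes _   | yes _   = refl
  ... | yes x≡y | no y≢x  = contradiction (sym x≡y) y≢x
  ... | no x≢y  | yes y≡x = contradiction (sym y≡x) x≢y
  ... | no _    | no _    = cong ∣_∣ (∩-comm (star H x) (star H y))

  mult-irrefl : ∀ x → mult x x ≡ 0
  mult-irrefl x with x ≟ x
  ... | yes _  = refl
  ... | no x≢x = contradiction refl x≢x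

IsColoring : (H : Hypergraph) {q : ℕ} → (Fin (size H) → Fin q) → Set
IsColoring H c =
  ∀ i j → c i ≡ c j → Empty (edge H i ∩ edge H j) ⊎ edge H i ≡ edge H j

Colorable : Hypergraph → ℕ → Set
Colorable H q = ∃ λ (c : Fin (size H) → Fin q) → IsColoring H c

isColoring? : ∀ H {q} (c : Fin (size H) → Fin q) → Dec (IsColoring H c)
isColoring? H c = all? λ i → all? λ j →
  (c i ≟ c j) →-dec
  (¬? (nonempty? (edge H i ∩ edge H j)) ⊎-dec ≡-dec Bool._≟_ (edge H i) (edge H j))

isColoring-resp : ∀ H {q} {c d : Fin (size H) → Fin q} →
                  c ≗ d → IsColoring H c → IsColoring H d
isColoring-resp H c≗d col i j di≡dj =
  col i j (trans (c≗d i) (trans di≡dj (sym (c≗d j))))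

colorable? : ∀ H → Decidable (Colorable H)
colorable? H q = map′
  (λ (t , col) → finToFun t , col)
  (λ (c , col) → funToFin c ,
     isColoring-resp H (λ i → sym (finToFun-funToFin c i)) col)
  (any? λ t → isColoring? H (finToFun {q} {size H} t))

colorable-size : ∀ H → Colorable H (size H)
colorable-size H = (λ i → i) , λ i j i≡j → inj₂ (cong (edge H) i≡j)

least : ∀ {p} {P : Pred ℕ p} → Decidable P → ∀ n → P n →
        ∃ λ m → P m × (∀ k → P k → m ≤ k)
least P? zero    p = zero , p , λ _ _ → z≤n
least P? (suc n) p with P? zero
... | yes p₀ = zero , p₀ , λ _ _ → z≤n
... | no ¬p₀ with least (λ k → P? (suc k)) n p
...   | m , pm , min = suc m , pm , λ where
          zero    p₀ → contradiction p₀ ¬p₀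
          (suc k) pk → s≤s (min k pk)

-- Opaque so that the exhaustive search is never unfolded; the two lemmas
-- after it characterise the chromatic index.
abstract
  chromaticIndex : Hypergraph → ℕ
  chromaticIndex H = proj₁ (least (colorable? H) (size H) (colorable-size H))

  chromaticIndex-colorable : ∀ H → Colorable H (chromaticIndex H)
  chromaticIndex-colorable H =
    proj₁ (proj₂ (least (colorable? H) (size H) (colorable-size H)))

  chromaticIndex-least : ∀ H q → Colorable H q → chromaticIndex H ≤ q
  chromaticIndex-least H =
    proj₂ (proj₂ (least (colorable? H) (size H) (colorable-size H)))

{-# OPTIONS --safe #-}

-- Two hyperedges sharing a vertex share exactly one, so the line graph is
-- k²-regular, while Δ + 1 = (k + 1)(k − 1) + 1 = k²: a Brooks-type bound is
-- needed.  Suppose S ∖ r is properly k²-coloured but S is not colourable.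
-- Then the neighbours of r carry all colours, once each, and the hole r can
-- be moved to any neighbour, which hands its colour to r.
--
-- Choose v and a so that r, v, a are three hyperedges through one vertex y.
-- Moving the hole r → a or r → v → a gives two colourings that differ only by
-- exchanging the colours of r and v; moving the hole further while avoiding
-- r and v preserves this, and it forces every hole adjacent to r to be
-- adjacent to v.  Let x ≠ y be another vertex of r.  Of the k + 1 hyperedges
-- through x some h misses v, by linearity and |v| = k.  Hence h is not in the
-- component C of a in the line graph without r and v, and exchanging the
-- colours of a and h on C gives a and h the same colour: contradiction.
module Submission where

open import Defs
open import Data.Bool.Base using (Bool; true; false; if_then_else_; _∧_)
open import Data.Fin.Base using (Fin; zero; suc; toℕ; fromℕ<; punchIn; punchOut; combine; remQuot)
open import Data.Fin.Permutation.Components using (transpose; transpose-inverse)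
open import Data.Fin.Properties
  using (_≟_; any?; all?; suc-injective; punchOut-injective; punchIn-punchOut; punchInᵢ≢i;
         injective⇒≤; remQuot-combine; toℕ-injective; toℕ<n; toℕ-fromℕ<; sequence)
open import Data.Fin.Subset using (Subset; inside; outside; _∈_; _∩_; ∣_∣; Nonempty)
open import Data.Fin.Subset.Properties using (_∈?_; nonempty?; x∈p∩q⁺; x∈p∩q⁻; ∩-idem)
open import Data.Nat.Base using (ℕ; zero; suc; _+_; _*_; _≤_; _<_; _⊔_; s≤s; s≤s⁻¹; >-nonZero⁻¹)
open import Data.Nat.Properties
  using (+-0-commutativeMonoid; +-comm; +-assoc; +-cancelʳ-≡; +-monoˡ-≤; ≤-trans; ≤-refl;
         ≤-reflexive; m≤m⊔n; m≤n⊔m; n≮n; n<1⇒n≡0; <-≤-trans; n≤1+n; ≤∧≢⇒<; <⇒≱; module ≤-Reasoning)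
  renaming (_<?_ to _<ℕ?_)
open import Data.Product.Base using (∃; _×_; _,_; proj₁; proj₂)
open import Data.Sum.Base using (inj₁; inj₂)
open import Data.Vec.Base using (_∷_; []; here; there; lookup)
open import Data.Vec.Functional using (Vector; foldr; updateAt; removeAt)
open import Data.Vec.Functional.Properties using (updateAt-updates; updateAt-minimal)
open import Data.Vec.Properties using (lookup∘tabulate; lookup-zipWith; lookup⇒[]=; []=⇒lookup)
open import Algebra.Properties.CommutativeMonoid.Sum +-0-commutativeMonoid
  using (sum; sum-remove; ∑-comm; sum-cong-≗; sum-replicate-zero)
open import Effect.Monad using (RawMonad)
open import Function.Base using (_∘_; const; case_of_)
open import Function.Definitions using (Injective)
open import Level using (0ℓ)
open import Relation.Binary.Core using (Rel)
import Relation.Binary.Definitions as B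
open import Relation.Binary.PropositionalEquality
  using (_≡_; _≢_; refl; sym; trans; cong; cong₂; subst; module ≡-Reasoning)
open import Relation.Nullary.Decidable
  using (Dec; yes; no; does; ¬?; _×-dec_; decidable-stable; ¬¬-excluded-middle; dec-true; dec-false)
open import Relation.Nullary.Negation using (¬_; contradiction; ¬¬-Monad)
open import Relation.Unary using (Pred; Decidable)

open Hypergraph

-- Injections and transpositions of a finite set.

injective⇒surjective : ∀ {n} {f : Fin n → Fin n} → Injective _≡_ _≡_ f → ∀ y → ∃ λ x → f x ≡ y
injective⇒surjective {suc n} {f} f-inj y with any? (λ x → f x ≟ y)
... | yes hit = hit
... | no miss = contradiction (injective⇒≤ punched-inj) (n≮n n)
  where
  y≢f : ∀ x → y ≢ f x
  y≢f x y≡fx = miss (x , sym y≡fx)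

  punched-inj : Injective _≡_ _≡_ (λ x → punchOut (y≢f x))
  punched-inj {x} {x′} = f-inj ∘ punchOut-injective (y≢f x) (y≢f x′)

transpose-injective : ∀ {n} (i j : Fin n) → Injective _≡_ _≡_ (transpose i j)
transpose-injective i j eq =
  trans (sym (transpose-inverse j i)) (trans (cong (transpose j i) eq) (transpose-inverse j i))

transpose-first : ∀ {n} (i j : Fin n) → transpose i j i ≡ j
transpose-first i j rewrite dec-true (i ≟ i) refl = refl

transpose-other : ∀ {n} {i j k : Fin n} → k ≢ i → k ≢ j → transpose i j k ≡ k
transpose-other {i = i} {j} {k} k≢i k≢j
  rewrite dec-false (k ≟ i) k≢i | dec-false (k ≟ j) k≢j = refl

-- Colouring a graph of bounded degree with a moving hole.

module _ {n d : ℕ} (_~_ : Rel (Fin n) 0ℓ) (~? : B.Decidable _~_) (~-sym : B.Symmetric _~_)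
         (~-irrefl : ∀ {i j} → i ~ j → i ≢ j)
         -- This bounds the degree by `d`: the list may repeat vertices or contain vertices not
         -- adjacent to `u`.
         (neighbours : ∀ u → ∃ λ (f : Fin d → Fin n) → ∀ {w} → u ~ w → ∃ λ j → f j ≡ w)
  where

  ProperOn : Pred (Fin n) 0ℓ → (Fin n → Fin d) → Set
  ProperOn S c = ∀ i j → S i → S j → i ~ j → c i ≢ c j

  _∖_ : Pred (Fin n) 0ℓ → Fin n → Pred (Fin n) 0ℓ
  (S ∖ x) i = S i × i ≢ x

  recolour-proper : ∀ {S x γ c} → ProperOn (S ∖ x) c → (∀ {j} → S j → x ~ j → c j ≢ γ) →
                    ProperOn S (updateAt c x (const γ))
  recolour-proper {x = x} {γ} {c} proper free i j i∈S j∈S i~j with i ≟ x | j ≟ x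
  ... | yes refl | yes refl = contradiction refl (~-irrefl i~j)
  ... | yes refl | no j≢x
    rewrite updateAt-updates x {const γ} c | updateAt-minimal j x {const γ} c j≢x = free j∈S i~j ∘ sym
  ... | no i≢x | yes refl
    rewrite updateAt-updates x {const γ} c | updateAt-minimal i x {const γ} c i≢x = free i∈S (~-sym i~j)
  ... | no i≢x | no j≢x
    rewrite updateAt-minimal i x {const γ} c i≢x | updateAt-minimal j x {const γ} c j≢x =
      proper _ _ (i∈S , i≢x) (j∈S , j≢x) i~j

  module Uncolourable {S : Pred (Fin n) 0ℓ} (S? : Decidable S) (stuck : ¬ ∃ (ProperOn S)) where

    module _ {x : Fin n} {c : Fin n → Fin d} (proper : ProperOn (S ∖ x) c) where

      private
        f : Fin d → Fin n
        f = proj₁ (neighbours x)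

      -- A colour absent from the neighbours of the hole `x` could be given to `x`, which would
      -- colour `S`.
      colour-occurs : ∀ γ → ∃ λ j → S (f j) × x ~ f j × c (f j) ≡ γ
      colour-occurs γ with any? (λ j → S? (f j) ×-dec ~? x (f j) ×-dec c (f j) ≟ γ)
      ... | yes found = found
      ... | no none = contradiction (updateAt c x (const γ) , recolour-proper {S = S} proper free) stuck
        where
        free : ∀ {j} → S j → x ~ j → c j ≢ γ
        free j∈S x~j cj≡γ with proj₂ (neighbours x) x~j
        ... | i , refl = none (i , j∈S , x~j , cj≡γ)

      occurrence-injective : Injective _≡_ _≡_ (proj₁ ∘ colour-occurs)
      occurrence-injective {γ} {δ} eq with colour-occurs γ | colour-occurs δ
      occurrence-injective refl | _ , _ , _ , p | _ , _ , _ , q = trans (sym p) q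

      -- The `d` colours occupy distinct positions in a list of length `d`, so by pigeonhole every
      -- position, and with it every neighbour, is the chosen occurrence of some colour.
      neighbour-occurs : ∀ {u} → x ~ u → ∃ λ γ → f (proj₁ (colour-occurs γ)) ≡ u
      neighbour-occurs x~u with proj₂ (neighbours x) x~u
      ... | j , refl with injective⇒surjective occurrence-injective j
      ...   | γ , eq = γ , cong f eq

      neighbour∈S : ∀ {u} → x ~ u → S u
      neighbour∈S x~u with neighbour-occurs x~u
      ... | γ , refl = proj₁ (proj₂ (colour-occurs γ))

      neighbour-colour : ∀ {u} ((γ , _) : ∃ λ γ → f (proj₁ (colour-occurs γ)) ≡ u) → c u ≡ γ
      neighbour-colour (γ , refl) = proj₂ (proj₂ (proj₂ (colour-occurs γ)))

      rainbow : ∀ {u w} → x ~ u → x ~ w → c u ≡ c w → u ≡ w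
      rainbow x~u x~w cu≡cw =
        let (γ , fγ≡u) = neighbour-occurs x~u
            (δ , fδ≡w) = neighbour-occurs x~w
            γ≡δ = trans (sym (neighbour-colour (γ , fγ≡u))) (trans cu≡cw (neighbour-colour (δ , fδ≡w)))
        in trans (sym fγ≡u) (trans (cong (f ∘ proj₁ ∘ colour-occurs) γ≡δ) fδ≡w)

      -- By `rainbow`, `y` is the only neighbour of `x` with colour `c y`; once `y` is the hole, `x`
      -- can take that colour.
      move-hole : ∀ {y} → x ~ y → ProperOn (S ∖ y) (updateAt c x (const (c y)))
      move-hole x~y = recolour-proper {S = S ∖ _}
        (λ _ _ ((i∈S , _) , i≢x) ((j∈S , _) , j≢x) → proper _ _ (i∈S , i≢x) (j∈S , j≢x))
        (λ (_ , j≢y) x~j → j≢y ∘ rainbow x~j x~y)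

    -- The invariant of the walking hole `x`. By `x≢r` and `x≢v` the next move leaves the colours of
    -- `r` and `v` alone; `differ` keeps their exchange from being trivial.
    record Twins (r v x : Fin n) : Set where
      field
        c c′    : Fin n → Fin d
        proper  : ProperOn (S ∖ x) c
        proper′ : ProperOn (S ∖ x) c′
        agree   : ∀ {i} → i ≢ r → i ≢ v → c i ≡ c′ i
        swap-r  : c r ≡ c′ v
        swap-v  : c v ≡ c′ r
        differ  : c r ≢ c v
        x≢r     : x ≢ r
        x≢v     : x ≢ v

    -- The hole walks r → a in one case and r → v → a in the other.
    twins-start : ∀ {r v a c} → ProperOn (S ∖ r) c → r ~ v → r ~ a → v ~ a → Twins r v a
    twins-start {r} {v} {a} {c} proper r~v r~a v~a = record
      { c = c₁
      ; c′ = c₃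
      ; proper = move-hole proper r~a
      ; proper′ = subst (λ γ → ProperOn (S ∖ a) (updateAt c₂ v (const γ))) c₂a≡ca
          (move-hole (move-hole proper r~v) v~a)
      ; agree = λ {i} i≢r i≢v → trans (updateAt-minimal i r c i≢r)
          (sym (trans (updateAt-minimal i v c₂ i≢v) (updateAt-minimal i r c i≢r)))
      ; swap-r = trans c₁r≡ca (sym (updateAt-updates v c₂))
      ; swap-v = trans c₁v≡cv (sym (trans (updateAt-minimal r v c₂ r≢v) (updateAt-updates r c)))
      ; differ = λ eq → v≢a (sym (rainbow proper r~a r~v (trans (sym c₁r≡ca) (trans eq c₁v≡cv))))
      ; x≢r = r≢a ∘ sym
      ; x≢v = v≢a ∘ sym
      }
      where
      r≢v = ~-irrefl r~v
      r≢a = ~-irrefl r~a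
      v≢a = ~-irrefl v~a
      c₁ = updateAt c r (const (c a))
      c₂ = updateAt c r (const (c v))
      c₃ = updateAt c₂ v (const (c a))
      c₂a≡ca : c₂ a ≡ c a
      c₂a≡ca = updateAt-minimal a r c (r≢a ∘ sym)
      c₁r≡ca : c₁ r ≡ c a
      c₁r≡ca = updateAt-updates r c
      c₁v≡cv : c₁ v ≡ c v
      c₁v≡cv = updateAt-minimal v r c (r≢v ∘ sym)

    -- Since `y` is neither `r` nor `v`, both colourings pass the same colour from `y` to `x`.
    twins-move : ∀ {r v x y} → Twins r v x → x ~ y → y ≢ r → y ≢ v → Twins r v y
    twins-move {r} {v} {x} {y} t x~y y≢r y≢v = record
      { c = updateAt c x (const (c y))
      ; c′ = updateAt c′ x (const (c′ y))
      ; proper = move-hole proper x~y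
      ; proper′ = move-hole proper′ x~y
      ; agree = agree₁
      ; swap-r = trans cr (trans swap-r (sym c′v))
      ; swap-v = trans cv (trans swap-v (sym c′r))
      ; differ = λ eq → differ (trans (sym cr) (trans eq cv))
      ; x≢r = y≢r
      ; x≢v = y≢v
      }
      where
      open Twins t
      cr  = updateAt-minimal r x {const (c y)} c (x≢r ∘ sym)
      cv  = updateAt-minimal v x {const (c y)} c (x≢v ∘ sym)
      c′r = updateAt-minimal r x {const (c′ y)} c′ (x≢r ∘ sym)
      c′v = updateAt-minimal v x {const (c′ y)} c′ (x≢v ∘ sym)
      agree₁ : ∀ {i} → i ≢ r → i ≢ v → updateAt c x (const (c y)) i ≡ updateAt c′ x (const (c′ y)) i
      agree₁ {i} i≢r i≢v with i ≟ x
      ... | yes refl = trans (updateAt-updates x c) (trans (agree y≢r y≢v) (sym (updateAt-updates x c′)))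
      ... | no i≢x = trans (updateAt-minimal i x c i≢x) (trans (agree i≢r i≢v) (sym (updateAt-minimal i x c′ i≢x)))

    -- The neighbour u of x with colour c v = c′ r is neither r nor v, so c′
    -- repeats that colour at u and r.
    twins-adjacent : ∀ {r v x} → Twins r v x → x ~ r → x ~ v
    twins-adjacent {r} {v} {x} t x~r with ~? x v
    ... | yes x~v = x~v
    ... | no x≁v = contradiction u≡r u≢r
      where
      open Twins t
      u = proj₁ (neighbours x) (proj₁ (colour-occurs proper (c v)))
      x~u : x ~ u
      x~u = proj₁ (proj₂ (proj₂ (colour-occurs proper (c v))))
      cu≡cv : c u ≡ c v
      cu≡cv = proj₂ (proj₂ (proj₂ (colour-occurs proper (c v))))
      u≢r : u ≢ r
      u≢r u≡r = differ (trans (sym (cong c u≡r)) cu≡cv)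
      u≢v : u ≢ v
      u≢v u≡v = x≁v (subst (x ~_) u≡v x~u)
      u≡r : u ≡ r
      u≡r = rainbow proper′ x~u x~r (trans (sym (agree u≢r u≢v)) (trans cu≡cv swap-v))

    module _ {r v : Fin n} {c : Fin n → Fin d} {α γ : Fin d} {C : Pred (Fin n) 0ℓ}
             (proper : ProperOn (S ∖ r) c)
             (closed : ∀ {x y} → C x → x ~ y → y ≢ r → y ≢ v → C y)
             (cv≢α : c v ≢ α) (cv≢γ : c v ≢ γ)
      where

      private
        -- An edge leaving `C` inside `S ∖ r` can only end at `v`, whose colour the transposition
        -- fixes; injectivity then keeps the colours of its ends distinct.
        boundary : ∀ {i j} → (S ∖ r) i → (S ∖ r) j → i ~ j → C i → ¬ C j → transpose α γ (c i) ≢ c j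
        boundary {i} {j} i∈ j∈ i~j i∈C j∉C with j ≟ v
        ... | yes refl = proper _ _ i∈ j∈ i~j ∘ transpose-injective α γ
                           ∘ (λ eq → trans eq (sym (transpose-other cv≢α cv≢γ)))
        ... | no j≢v = contradiction (closed i∈C i~j (proj₂ j∈) j≢v) j∉C

      kempe-swap : (C? : Decidable C) →
                   ProperOn (S ∖ r) (λ i → if does (C? i) then transpose α γ (c i) else c i)
      kempe-swap C? i j i∈ j∈ i~j with C? i | C? j
      ... | yes _   | yes _   = proper _ _ i∈ j∈ i~j ∘ transpose-injective α γ
      ... | no _    | no _    = proper _ _ i∈ j∈ i~j
      ... | yes i∈C | no j∉C  = boundary i∈ j∈ i~j i∈C j∉C
      ... | no i∉C  | yes j∈C = boundary j∈ i∈ (~-sym i~j) j∈C i∉C ∘ sym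

    no-proper-off : ∀ {r v a h c} → r ~ v → r ~ a → v ~ a → r ~ h → ¬ v ~ h → h ≢ v → ¬ ProperOn (S ∖ r) c
    no-proper-off {r} {v} {a} {h} {c} r~v r~a v~a r~h v≁h h≢v proper =
      -- The goal is a negation, so `C` may be taken as decidable: `sequence` pulls the double
      -- negation out of finitely many instances of excluded middle.
      sequence rawApplicative (λ _ → ¬¬-excluded-middle) λ C? → swap-fails C?
      where
      open RawMonad (¬¬-Monad {0ℓ}) using (rawApplicative)

      -- Closed under adjacency away from r and v, so it serves as the component
      -- of a without any notion of path.
      C : Pred (Fin n) 0ℓ
      C = Twins r v

      a∈C : C a
      a∈C = twins-start proper r~v r~a v~a

      h∉C : ¬ C h
      h∉C t = v≁h (~-sym (twins-adjacent t (~-sym r~h)))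

      swap-fails : ¬ Decidable C
      -- After the exchange `a` and `h` both carry the colour `c h`; `rainbow` at `r` identifies
      -- them, although `v` is adjacent to `a` and not to `h`.
      swap-fails C? = v≁h (subst (v ~_) (rainbow swapped r~a r~h (trans a↦ (sym h↦))) v~a)
        where
        c₁ : Fin n → Fin d
        c₁ i = if does (C? i) then transpose (c a) (c h) (c i) else c i

        swapped : ProperOn (S ∖ r) c₁
        swapped = kempe-swap proper twins-move
          -- By `rainbow` at `r`, the colour of `v` is neither of the two exchanged colours.
          (~-irrefl v~a ∘ rainbow proper r~v r~a) (h≢v ∘ sym ∘ rainbow proper r~v r~h) C?

        a↦ : c₁ a ≡ c h
        a↦ rewrite dec-true (C? a) a∈C = transpose-first (c a) (c h)

        h↦ : c₁ h ≡ c h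
        h↦ rewrite dec-false (C? h) h∉C = refl

  -- Vertices are added in index order, the newest being the hole `r`. The double negation stays
  -- because each step refutes uncolourability without producing a colouring.
  properly-colourable :
    (∀ r → ∃ λ v → ∃ λ a → ∃ λ h → r ~ v × r ~ a × v ~ a × r ~ h × ¬ v ~ h × h ≢ v) →
    ∀ t → t ≤ n → ¬ ¬ ∃ (ProperOn (λ i → toℕ i < t))
  properly-colourable local zero    _   no-colouring =
    -- Nothing is to be coloured yet, but a map into `Fin d` must exist: the position of a neighbour
    -- of `i` in its list serves as default colour.
    no-colouring ((λ i → proj₁ (proj₂ (neighbours i) (proj₁ (proj₂ (proj₂ (proj₂ (local i))))))) , λ _ _ ())
  properly-colourable local (suc t) t<n stuck =
    properly-colourable local t (≤-trans (n≤1+n t) t<n) λ (c , proper) →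
      let (_ , _ , _ , r~v , r~a , v~a , r~h , v≁h , h≢v) = local r
      in no-proper-off r~v r~a v~a r~h v≁h h≢v
           (λ _ _ i∈ j∈ → proper _ _ (earlier i∈) (earlier j∈))
    where
    open Uncolourable {λ i → toℕ i < suc t} (λ i → toℕ i <ℕ? suc t) stuck
    r = fromℕ< t<n

    earlier : ∀ {i} → ((λ i → toℕ i < suc t) ∖ r) i → toℕ i < t
    earlier (i<1+t , i≢r) = ≤∧≢⇒< (s≤s⁻¹ i<1+t)
      λ i≡t → i≢r (toℕ-injective (trans i≡t (sym (toℕ-fromℕ< t<n))))

-- Enumerating finite subsets, and a pigeonhole principle.

elements : ∀ {n} (p : Subset n) → Fin ∣ p ∣ → Fin n
elements (inside  ∷ p) zero    = zero
elements (inside  ∷ p) (suc i) = suc (elements p i)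
elements (outside ∷ p) i       = suc (elements p i)

elements-∈ : ∀ {n} (p : Subset n) i → elements p i ∈ p
elements-∈ (inside  ∷ p) zero    = here
elements-∈ (inside  ∷ p) (suc i) = there (elements-∈ p i)
elements-∈ (outside ∷ p) i       = there (elements-∈ p i)

elements-injective : ∀ {n} (p : Subset n) → Injective _≡_ _≡_ (elements p)
elements-injective (inside  ∷ p) {zero}  {zero}  _  = refl
elements-injective (inside  ∷ p) {suc i} {suc j} eq = cong suc (elements-injective p (suc-injective eq))
elements-injective (outside ∷ p)                 eq = elements-injective p (suc-injective eq)

elements-surjective : ∀ {n} {p : Subset n} {x} → x ∈ p → ∃ λ i → elements p i ≡ x
elements-surjective {p = inside ∷ p}  here = zero , refl
elements-surjective {p = inside ∷ p}  (there x∈p) with elements-surjective x∈p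
... | i , refl = suc i , refl
elements-surjective {p = outside ∷ p} (there x∈p) with elements-surjective x∈p
... | i , refl = i , refl

∣p∣≤1⇒x≡y : ∀ {n} {p : Subset n} {x y} → ∣ p ∣ ≤ 1 → x ∈ p → y ∈ p → x ≡ y
∣p∣≤1⇒x≡y ∣p∣≤1 x∈p y∈p with elements-surjective x∈p | elements-surjective y∈p
... | i , refl | j , refl = cong (elements _) (toℕ-injective (trans (is-zero i) (sym (is-zero j))))
  where
  is-zero : ∀ i → toℕ i ≡ 0
  is-zero i = n<1⇒n≡0 (<-≤-trans (toℕ<n i) ∣p∣≤1)

-- Skipping the position of `x` saves one entry: of k + 1 hyperedges through a vertex, k remain
-- besides a given one.
elements-without : ∀ {n k} {p : Subset n} {x} → ∣ p ∣ ≡ suc k → x ∈ p →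
                   ∃ λ (f : Fin k → Fin n) → ∀ {y} → y ∈ p → y ≢ x → ∃ λ i → f i ≡ y
elements-without {n} {k} {p} ∣p∣≡1+k x∈p
  with ∣ p ∣ | elements p | elements-surjective {p = p} | elements-surjective x∈p
elements-without {n} {k} {p} refl x∈p | _ | f | onto | i , refl =
  f ∘ punchIn i , λ y∈p y≢x → hit (onto y∈p) y≢x
  where
  hit : ∀ {y} → (∃ λ j → f j ≡ y) → y ≢ f i → ∃ λ j → f (punchIn i j) ≡ y
  hit (j , refl) fj≢fi = punchOut i≢j , cong f (punchIn-punchOut i≢j)
    where
    i≢j : i ≢ j
    i≢j = fj≢fi ∘ cong f ∘ sym

-- If every element of `p` had a partner `j`, choosing partners would inject `p` into the smaller
-- `Fin m`.
unmatched : ∀ {n m} {p : Subset n} {R : Fin n → Fin m → Set} → (∀ x j → Dec (R x j)) → m < ∣ p ∣ →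
            (∀ {x y j} → x ∈ p → y ∈ p → R x j → R y j → x ≡ y) → ∃ λ x → x ∈ p × ∀ j → ¬ R x j
unmatched {p = p} {R} R? m<∣p∣ unique with any? (λ i → all? λ j → ¬? (R? (elements p i) j))
... | yes (i , free) = elements p i , elements-∈ p i , free
... | no none = contradiction (injective⇒≤ partner-injective) (<⇒≱ m<∣p∣)
  where
  partner : ∀ i → ∃ λ j → R (elements p i) j
  partner i with any? (R? (elements p i))
  ... | yes found = found
  ... | no ¬found = contradiction (i , λ j Rij → ¬found (j , Rij)) none

  partner-injective : Injective _≡_ _≡_ (proj₁ ∘ partner)
  partner-injective {i} {i′} eq = elements-injective p
    (unique (elements-∈ p i) (elements-∈ p i′) (proj₂ (partner i))
       (subst (R (elements p i′)) (sym eq) (proj₂ (partner i′))))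

another : ∀ {n m} {p : Subset n} (f : Fin m → Fin n) → m < ∣ p ∣ → ∃ λ x → x ∈ p × ∀ j → x ≢ f j
another f m<∣p∣ = unmatched (λ x j → x ≟ f j) m<∣p∣ λ _ _ x≡fj y≡fj → trans x≡fj (sym y≡fj)

-- Double counting of degrees in the 2-section.

indicator : Bool → ℕ
indicator b = if b then 1 else 0

sum-indicator : ∀ {n} (p : Subset n) → sum (indicator ∘ lookup p) ≡ ∣ p ∣
sum-indicator []            = refl
sum-indicator (inside  ∷ p) = cong suc (sum-indicator p)
sum-indicator (outside ∷ p) = sum-indicator p

sum-if : ∀ {n} (p : Subset n) k → sum (λ i → if lookup p i then k else 0) ≡ ∣ p ∣ * k
sum-if []            k = refl
sum-if (inside  ∷ p) k = cong (k +_) (sum-if p k)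
sum-if (outside ∷ p) k = sum-if p k

sum-indicator-∧ : ∀ {n} b (p : Subset n) →
                  sum (λ i → indicator (b ∧ lookup p i)) ≡ (if b then ∣ p ∣ else 0)
sum-indicator-∧ {n} false p = sum-replicate-zero n
sum-indicator-∧     true  p = sum-indicator p

does-∈? : ∀ {n} (x : Fin n) (p : Subset n) → does (x ∈? p) ≡ lookup p x
does-∈? zero    (inside  ∷ p) = refl
does-∈? zero    (outside ∷ p) = refl
does-∈? (suc x) (_ ∷ p)       = does-∈? x p

≤-foldr-⊔ : ∀ {n} (f : Vector ℕ n) i → f i ≤ foldr _⊔_ 0 f
≤-foldr-⊔ f zero    = m≤m⊔n (f zero) _
≤-foldr-⊔ f (suc i) = ≤-trans (≤-foldr-⊔ (f ∘ suc) i) (m≤n⊔m (f zero) _)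

module _ (H : Hypergraph) where

  lookup-star : ∀ x e → lookup (star H x) e ≡ lookup (edge H e) x
  lookup-star x e = trans (lookup∘tabulate _ e) (does-∈? x (edge H e))

  ∈-star⁺ : ∀ {x e} → x ∈ edge H e → e ∈ star H x
  ∈-star⁺ {x} {e} x∈e = lookup⇒[]= e _ (trans (lookup-star x e) ([]=⇒lookup x∈e))

  ∈-star⁻ : ∀ {x e} → e ∈ star H x → x ∈ edge H e
  ∈-star⁻ {x} {e} e∈x = lookup⇒[]= x _ (trans (sym (lookup-star x e)) ([]=⇒lookup e∈x))

  -- Double count of the pairs (y, e) with x and y in e: each hyperedge through `x` contributes its
  -- `k` vertices.
  sum-star-∩ : ∀ {k} → Uniform k H → ∀ x → sum (λ y → ∣ star H x ∩ star H y ∣) ≡ degree H x * k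
  sum-star-∩ {k} uniform x = begin
    sum (λ y → ∣ star H x ∩ star H y ∣)
      ≡⟨ sum-cong-≗ (λ y → sum-indicator (star H x ∩ star H y)) ⟨
    sum (λ y → sum (λ e → indicator (lookup (star H x ∩ star H y) e)))
      ≡⟨ sum-cong-≗ (λ y → sum-cong-≗ (λ e → cong indicator (both y e))) ⟩
    sum (λ y → sum (λ e → indicator (lookup (star H x) e ∧ lookup (edge H e) y)))
      ≡⟨ ∑-comm (λ y e → indicator (lookup (star H x) e ∧ lookup (edge H e) y)) ⟩
    sum (λ e → sum (λ y → indicator (lookup (star H x) e ∧ lookup (edge H e) y)))
      ≡⟨ sum-cong-≗ (λ e → trans (sum-indicator-∧ (lookup (star H x) e) (edge H e))
                             (cong (if lookup (star H x) e then_else 0) (uniform e))) ⟩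
    sum (λ e → if lookup (star H x) e then k else 0)
      ≡⟨ sum-if (star H x) k ⟩
    degree H x * k ∎
    where
    open ≡-Reasoning
    both : ∀ y e → lookup (star H x ∩ star H y) e ≡ lookup (star H x) e ∧ lookup (edge H e) y
    both y e = trans (lookup-zipWith _∧_ e (star H x) (star H y))
                 (cong (lookup (star H x) e ∧_) (lookup-star y e))

  open LooplessMultigraph

  -- The two sums differ only in the term at y = x: it is the degree of `x` on the left, and 0 in
  -- the loopless multigraph.
  sum-multiplicity : ∀ x → sum (λ y → ∣ star H x ∩ star H y ∣) ≡ degree H x + graphDegree [ H ]₂ x
  sum-multiplicity x = split x (λ y → ∣ star H x ∩ star H y ∣) (multiplicity [ H ]₂ x)
    (cong ∣_∣ (∩-idem (star H x))) (loopless [ H ]₂ x) off-diagonal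
    where
    off-diagonal : ∀ y → x ≢ y → ∣ star H x ∩ star H y ∣ ≡ multiplicity [ H ]₂ x y
    off-diagonal y x≢y rewrite dec-false (x ≟ y) x≢y = refl

    split : ∀ {n d} (i : Fin n) (f g : Vector ℕ n) → f i ≡ d → g i ≡ 0 → (∀ j → i ≢ j → f j ≡ g j) →
            sum f ≡ d + sum g
    split {suc n} {d} i f g fi≡d gi≡0 f≗g = begin
      sum f                        ≡⟨ sum-remove {i = i} f ⟩
      f i + sum (removeAt f i)     ≡⟨ cong₂ _+_ fi≡d (sum-cong-≗ λ j → f≗g (punchIn i j) (punchInᵢ≢i i j ∘ sym)) ⟩
      d + sum (removeAt g i)       ≡⟨ cong (λ m → d + (m + sum (removeAt g i))) gi≡0 ⟨
      d + (g i + sum (removeAt g i)) ≡⟨ cong (d +_) (sum-remove {i = i} g) ⟨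
      d + sum g                    ∎
      where open ≡-Reasoning

  -- A vertex of degree D in the 2-section satisfies (k + 1)k = (k + 1) + D, hence D + 1 = k².
  k*k≤Δ+1 : ∀ {k} → Uniform k H → Regular (k + 1) H → k * k ≤ Δ [ H ]₂ + 1
  k*k≤Δ+1 {k} uniform regular = begin
    k * k                     ≡⟨ +-cancelʳ-≡ k (k * k) (graphDegree [ H ]₂ x + 1) degrees ⟩
    graphDegree [ H ]₂ x + 1  ≤⟨ +-monoˡ-≤ 1 (≤-foldr-⊔ (graphDegree [ H ]₂) x) ⟩
    Δ [ H ]₂ + 1              ∎
    where
    open ≤-Reasoning
    x : Vertex H
    x = fromℕ< {0} (>-nonZero⁻¹ (order H) {{order-nonZero H}})

    degrees : k * k + k ≡ graphDegree [ H ]₂ x + 1 + k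
    degrees = begin-equality
      k * k + k                    ≡⟨ +-comm (k * k) k ⟩
      suc k * k                    ≡⟨ cong (_* k) (+-comm 1 k) ⟩
      (k + 1) * k                  ≡⟨ cong (_* k) (regular x) ⟨
      degree H x * k               ≡⟨ sum-star-∩ uniform x ⟨
      sum (λ y → ∣ star H x ∩ star H y ∣) ≡⟨ sum-multiplicity x ⟩
      degree H x + D               ≡⟨ cong (_+ D) (regular x) ⟩
      (k + 1) + D                  ≡⟨ +-comm (k + 1) D ⟩
      D + (k + 1)                  ≡⟨ cong (D +_) (+-comm k 1) ⟩
      D + (1 + k)                  ≡⟨ +-assoc D 1 k ⟨
      D + 1 + k                    ∎
      where D = graphDegree [ H ]₂ x

  -- The line graph and its degree bound.

  _⌢_ : Rel (Fin (size H)) 0ℓ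
  e ⌢ f = e ≢ f × Nonempty (edge H e ∩ edge H f)

  ⌢-at : ∀ {e f x} → e ≢ f → x ∈ edge H e → x ∈ edge H f → e ⌢ f
  ⌢-at e≢f x∈e x∈f = e≢f , _ , x∈p∩q⁺ (x∈e , x∈f)

  ⌢-sym : ∀ {e f} → e ⌢ f → f ⌢ e
  ⌢-sym {e} {f} (e≢f , x , x∈) =
    let (x∈e , x∈f) = x∈p∩q⁻ (edge H e) (edge H f) x∈ in ⌢-at (e≢f ∘ sym) x∈f x∈e

  -- A neighbour of `e` is located by one of the k vertices of `e` and a position among the k other
  -- hyperedges there; `combine` codes such pairs.
  ⌢-neighbours : ∀ {k} → Uniform k H → Regular (k + 1) H →
    ∀ e → ∃ λ (nbr : Fin (k * k) → Fin (size H)) → ∀ {f} → e ⌢ f → ∃ λ j → nbr j ≡ f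
  ⌢-neighbours {k} uniform regular e
    with ∣ edge H e ∣ | uniform e | elements (edge H e) | elements-∈ (edge H e)
       | elements-surjective {p = edge H e}
  ... | _ | refl | point | point∈e | point-onto =
    (λ j → let (a , b) = remQuot k j in proj₁ (others a) b) , cover
    where
    others : ∀ a → ∃ λ (nbr : Fin k → Fin (size H)) →
             ∀ {f} → f ∈ star H (point a) → f ≢ e → ∃ λ j → nbr j ≡ f
    others a = elements-without (trans (regular (point a)) (+-comm k 1)) (∈-star⁺ (point∈e a))

    cover : ∀ {f} → e ⌢ f → ∃ λ j → proj₁ (others (proj₁ (remQuot k j))) (proj₂ (remQuot {k} k j)) ≡ f
    cover {f} (e≢f , x , x∈) with x∈p∩q⁻ (edge H e) (edge H f) x∈
    ... | x∈e , x∈f with point-onto x∈e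
    ...   | a , refl with proj₂ (others a) (∈-star⁺ x∈f) (e≢f ∘ sym)
    ...     | b , eq = combine a b ,
      trans (cong (λ (a , b) → proj₁ (others a) b) (remQuot-combine a b)) eq

  -- Local structure from linearity, and the colouring with k² colours.

  module _ {k} (2≤k : 2 ≤ k) (uniform : Uniform k H) (regular : Regular (k + 1) H) (linear : Linear H) where

    common-point-unique : ∀ {e f x y} → e ≢ f → x ∈ edge H e → x ∈ edge H f →
                          y ∈ edge H e → y ∈ edge H f → x ≡ y
    common-point-unique {e} {f} e≢f x∈e x∈f y∈e y∈f =
      ∣p∣≤1⇒x≡y (linear e f (e≢f ∘ edge-injective H)) (x∈p∩q⁺ (x∈e , x∈f)) (x∈p∩q⁺ (y∈e , y∈f))

    degree≡1+k : ∀ x → degree H x ≡ suc k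
    degree≡1+k x = trans (regular x) (+-comm k 1)

    -- As `x` is outside `v`, linearity puts each of the k vertices of `v` on at most one of the k +
    -- 1 hyperedges through `x`, so one of these avoids `v`.
    disjoint-from : ∀ {x v} → ¬ x ∈ edge H v → ∃ λ h → x ∈ edge H h × ∀ {z} → z ∈ edge H v → ¬ z ∈ edge H h
    disjoint-from {x} {v} x∉v =
      let (h , h∈x , misses) = unmatched (λ h j → elements (edge H v) j ∈? edge H h) k<degree unique
      in h , ∈-star⁻ h∈x , λ z∈v → case elements-surjective z∈v of λ where (j , refl) → misses j
      where
      k<degree : ∣ edge H v ∣ < degree H x
      k<degree = ≤-reflexive (trans (cong suc (uniform v)) (sym (degree≡1+k x)))

      unique : ∀ {f g j} → f ∈ star H x → g ∈ star H x → elements (edge H v) j ∈ edge H f →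
               elements (edge H v) j ∈ edge H g → f ≡ g
      unique {f} {g} {j} f∈x g∈x z∈f z∈g with f ≟ g
      ... | yes f≡g = f≡g
      ... | no f≢g = contradiction
        (subst (_∈ edge H v) (common-point-unique f≢g z∈f z∈g (∈-star⁻ f∈x) (∈-star⁻ g∈x))
          (elements-∈ (edge H v) j))
        x∉v

    local-structure : ∀ r → ∃ λ v → ∃ λ a → ∃ λ h → r ⌢ v × r ⌢ a × v ⌢ a × r ⌢ h × ¬ v ⌢ h × h ≢ v
    local-structure r =
      let (y , y∈r) = edge-nonempty H r
          -- k ≥ 2 gives `r` a second vertex `x`, and degree k + 1 ≥ 3 gives `y` two further
          -- hyperedges `v` and `a`.
          (x , x∈r , x≢y) = another {m = 1} {p = edge H r} (const y) (subst (2 ≤_) (sym (uniform r)) 2≤k)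
          2<degree = subst (2 <_) (sym (degree≡1+k y)) (s≤s 2≤k)
          (v , v∈y , v≢r) = another {m = 1} {p = star H y} (const r) (≤-trans (n≤1+n 2) 2<degree)
          (a , a∈y , a≢) = another {p = star H y} (lookup (r ∷ v ∷ [])) 2<degree
          y∈v = ∈-star⁻ v∈y
          y∈a = ∈-star⁻ a∈y
          -- `r` and `v` already meet in `y`, so they cannot also share `x`.
          x∉v = λ x∈v → x≢y zero (common-point-unique (v≢r zero) x∈v x∈r y∈v y∈r)
          (h , x∈h , h∩v) = disjoint-from x∉v
      in v , a , h
       , ⌢-at (v≢r zero ∘ sym) y∈r y∈v
       , ⌢-at (a≢ zero ∘ sym) y∈r y∈a
       , ⌢-at (a≢ (suc zero) ∘ sym) y∈v y∈a
       , ⌢-at (λ r≡h → h∩v y∈v (subst (λ e → y ∈ edge H e) r≡h y∈r)) x∈r x∈h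
       , (λ (_ , z , z∈) → let (z∈v , z∈h) = x∈p∩q⁻ (edge H v) (edge H h) z∈ in h∩v z∈v z∈h)
       , λ h≡v → x∉v (subst (λ e → x ∈ edge H e) h≡v x∈h)

    k*k-colorable : Colorable H (k * k)
    -- Colourability is decidable by finite search, so the double negation can be removed.
    k*k-colorable = decidable-stable (colorable? H (k * k)) λ none →
      properly-colourable _⌢_ (λ e f → ¬? (e ≟ f) ×-dec nonempty? (edge H e ∩ edge H f)) ⌢-sym proj₁
        (⌢-neighbours uniform regular) local-structure (size H) ≤-refl
        λ (c , proper) → none (c , isColoring c λ {e} {f} → proper e f (toℕ<n e) (toℕ<n f))
      where
      isColoring : ∀ c → (∀ {e f} → e ⌢ f → c e ≢ c f) → IsColoring H c
      isColoring c proper e f ce≡cf with e ≟ f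
      ... | yes refl = inj₂ refl
      ... | no e≢f = inj₁ λ meet → proper (e≢f , meet) ce≡cf

theorem2 : ∀ (k : ℕ) → 2 ≤ k → (H : Hypergraph) →
    Uniform k H → Regular (k + 1) H → Linear H →
    chromaticIndex H ≤ Δ [ H ]₂ + 1
theorem2 k 2≤k H uniform regular linear =
  ≤-trans (chromaticIndex-least H (k * k) (k*k-colorable H 2≤k uniform regular linear))
    (k*k≤Δ+1 H uniform regular)
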